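{- Let $S$ be a closed subsemigroup of $\mathbb{N}^\mathbb{N}$ with $|S|=2^{\aleph_0}$. Then there exists a closed subsemigroup $T$ of $\mathfrak{F}_2$ such that $|T| = 2^{\aleph_0}$ and $T\preccurlyeq S$.
   Context: $\mathbb{N}=\{0,1,2,\ldots\}$ and $\mathbb{N}^\mathbb{N}$ is the semigroup of all maps $\mathbb{N}\to\mathbb{N}$ under composition, equipped with the product topology arising from the discrete topology on $\mathbb{N}$; "closed" refers to this topology. $\mathfrak{F}_2=\{f\in\mathbb{N}^\mathbb{N} : |f(\mathbb{N})|\leq 2\}$. For $U,V\subseteq\mathbb{N}^\mathbb{N}$, write $U\preccurlyeq V$ if there is a countable $C\subseteq\mathbb{N}^\mathbb{N}$ such that $U$ is contained in the subsemigroup of $\mathbb{N}^\mathbb{N}$ generated by $V\cup C$. -}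

module Defs where

open import Data.Nat using (ℕ; _<_)
open import Data.Bool using (Bool)
open import Data.Product using (Σ; ∃; _×_; _,_; proj₁)
open import Data.Sum using (_⊎_)
open import Relation.Nullary using (¬_)
open import Relation.Binary.PropositionalEquality using (_≡_)
open import Function using (_∘_)

-- Baire space ℕ^ℕ; maps are identified up to pointwise equality.
Baire : Set
Baire = ℕ → ℕ

_≈B_ : Baire → Baire → Set
f ≈B g = ∀ n → f n ≡ g n

Subset : Set₁
Subset = Baire → Set

_⊆_ : Subset → Subset → Set
U ⊆ V = ∀ f → U f → V f

_∪_ : Subset → Subset → Subset
(U ∪ V) f = U f ⊎ V f

IsSubsemigroup : Subset → Set
IsSubsemigroup S = ∀ f g → S f → S g → S (f ∘ g)

-- S is closed in the product topology (discrete ℕ): S contains every f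
-- lying in its closure, i.e. every f each of whose basic open
-- neighbourhoods {g : g i = f i for i < n} meets S.
IsClosed : Subset → Set
IsClosed S = ∀ f → (∀ n → ∃ λ g → S g × (∀ i → i < n → g i ≡ f i)) → S f

Cantor : Set
Cantor = ℕ → Bool

_≈C_ : Cantor → Cantor → Set
x ≈C y = ∀ n → x n ≡ y n

HasContinuumCard : Subset → Set
HasContinuumCard S =
  Σ (Cantor → Σ Baire S) λ φ →
    (∀ x y → x ≈C y → proj₁ (φ x) ≈B proj₁ (φ y)) ×
    (∀ x y → proj₁ (φ x) ≈B proj₁ (φ y) → x ≈C y) ×
    (∀ f → S f → ∃ λ x → proj₁ (φ x) ≈B f)

F₂ : Subset
F₂ f = ∃ λ a → ∃ λ b → ∀ n → f n ≡ a ⊎ f n ≡ b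

-- C is countable: C is contained in the range of some sequence
-- (this includes the empty set).
Countable : Subset → Set
Countable C = ∃ λ (e : ℕ → Baire) → ∀ f → C f → ∃ λ n → e n ≈B f

-- Subsemigroup of ℕ^ℕ generated by W (closed under pointwise equality,
-- since elements of ℕ^ℕ are maps up to extensional equality).
data Gen (W : Subset) : Subset where
  gen-base : ∀ {f} → W f → Gen W f
  gen-comp : ∀ {f g} → Gen W f → Gen W g → Gen W (f ∘ g)
  gen-ext  : ∀ {f g} → Gen W f → f ≈B g → Gen W g

_≼_ : Subset → Subset → Set₁
U ≼ V = Σ Subset λ C → Countable C × (U ⊆ Gen (V ∪ C))

-- Excluded middle (classical metatheory of the paper).
LEM : Set₁
LEM = (A : Set) → A ⊎ ¬ A

{-# OPTIONS --safe #-}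

-- Call a set A of maps w-large if {w ∘ f : f ∈ A} is uncountable.  A w-large
-- set has a coordinate n and values a ≢ b such that both {f ∈ A : w (f n) = a}
-- and {f ∈ A : w (f n) = b} are w-large.
--
-- There are a colouring u : ℕ → {0,1} and a map w such that every w-large basic
-- open subset of S contains two w-large ones separated by u (f n) for some n.
-- If the indicator w of some point makes S w-large, take u = w.  Otherwise take
-- w = id: each fibre f⁻¹(c) has only countably many possibilities, so every
-- large A ⊆ S has a large subset on which the fibres over all c < N are
-- constant, and splitting that subset gives values a, b ≥ N.  Running through
-- the countably many basic open sets, fresh pairs (a, b) can be chosen for all
-- of them at once and coloured 0 and 1.
--
-- The resulting Cantor scheme yields f_x ∈ S for x ∈ 2^ℕ, with x ↦ u ∘ f_x
-- injective and f_x(0) independent of x.  If v maps 0 and 1 to 0 and n + 2 to n,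
-- the maps u ∘ f_x ∘ v take values in {0,1} and agree at 0 and 1, so any two of
-- them compose to the same constant map c; take T = {u ∘ f_x ∘ v} ∪ {c}.

module Submission where

open import Defs
open import Data.Bool using (Bool; true; false; not)
open import Data.Bool.Properties using (not-¬)
open import Data.Empty using (⊥; ⊥-elim)
open import Data.Nat using (ℕ; zero; suc; _+_; _≤_; _<_; z≤n; s≤s; z<s; s<s; _≡ᵇ_; _<ᵇ_)
open import Data.Nat.Properties
open import Data.Product using (Σ; ∃; _×_; _,_; proj₁; proj₂)
open import Data.Sum using (_⊎_; inj₁; inj₂; [_,_]′; fromInj₁)
open import Function using (_∘_; id)
open import Relation.Binary using (tri<; tri≈; tri>)
open import Relation.Binary.PropositionalEquality
open import Relation.Nullary using (¬_)

≈B-refl : ∀ {f} → f ≈B f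
≈B-refl _ = refl

≈B-sym : ∀ {f g} → f ≈B g → g ≈B f
≈B-sym p n = sym (p n)

≈B-trans : ∀ {f g h} → f ≈B g → g ≈B h → f ≈B h
≈B-trans p q n = trans (p n) (q n)

≈C-sym : ∀ {x y} → x ≈C y → y ≈C x
≈C-sym p n = sym (p n)

≈C-trans : ∀ {x y z} → x ≈C y → y ≈C z → x ≈C z
≈C-trans p q n = trans (p n) (q n)

Agree : ℕ → Baire → Baire → Set
Agree m f g = ∀ i → i < m → f i ≡ g i

_∩_ : Subset → Subset → Subset
(A ∩ B) f = A f × B f

Cyl : Baire → ℕ → Subset
Cyl g m f = Agree m f g

bit : Bool → ℕ
bit false = 0
bit true  = 1

isOne : ℕ → Bool
isOne n = n ≡ᵇ 1

isOne-bit : ∀ b → isOne (bit b) ≡ b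
isOne-bit false = refl
isOne-bit true  = refl

-- Enumerations of ℕ × ℕ and of the basic open sets

next : ℕ × ℕ → ℕ × ℕ
next (zero  , j) = suc j , 0
next (suc i , j) = i , suc j

unpair : ℕ → ℕ × ℕ
unpair zero    = 0 , 0
unpair (suc n) = next (unpair n)

private
  -- `next` runs along each diagonal from `(s , 0)` to `(0 , s)`, so the induction steps back to
  -- predecessors; that of `(suc i , 0)` ends the previous diagonal.
  unpair-diagonal : ∀ s i j → i + j ≡ s → ∃ λ n → unpair n ≡ (i , j)
  unpair-diagonal zero    zero    zero    _  = 0 , refl
  unpair-diagonal (suc s) (suc i) zero    eq =
    let n , p = unpair-diagonal s 0 i (trans (sym (+-identityʳ i)) (suc-injective eq))
    in suc n , cong next p
  unpair-diagonal s       i       (suc j) eq =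
    let n , p = unpair-diagonal s (suc i) j (trans (sym (+-suc i j)) eq)
    in suc n , cong next p

unpair-surjective : ∀ i j → ∃ λ n → unpair n ≡ (i , j)
unpair-surjective i j = unpair-diagonal (i + j) i j refl

finite : ℕ → ℕ → Baire
finite zero    c _       = 0
finite (suc m) c zero    = proj₁ (unpair c)
finite (suc m) c (suc i) = finite m (proj₂ (unpair c)) i

finite-surjective : ∀ m g → ∃ λ c → Agree m (finite m c) g
finite-surjective zero    g = 0 , λ _ ()
finite-surjective (suc m) g with finite-surjective m (g ∘ suc)
... | c , ag with unpair-surjective (g 0) c
... | d , eq = d , λ where
  zero    _       → cong proj₁ eq
  (suc i) (s≤s p) → trans (cong (λ q → finite m (proj₂ q) i) eq) (ag i p)

finiteCyl : ℕ × ℕ → Subset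
finiteCyl (m , c) = Cyl (finite m c) m

cylAt : ℕ → Subset
cylAt k = finiteCyl (unpair k)

cylAt-surjective : ∀ g m → ∃ λ k → (cylAt k ⊆ Cyl g m) × (Cyl g m ⊆ cylAt k)
cylAt-surjective g m =
  let c , ag = finite-surjective m g
      k , eq = unpair-surjective m c
  in k , subst (λ q → (finiteCyl q ⊆ Cyl g m) × (Cyl g m ⊆ finiteCyl q)) (sym eq)
    ( (λ f p i i<m → trans (p i i<m) (ag i i<m))
    , (λ f p i i<m → trans (p i i<m) (sym (ag i i<m))))

-- Sets with countable image under composition with `w`.

record Small (w : Baire) (A : Subset) : Set where
  constructor covered
  field
    enum   : ℕ → Baire
    covers : ∀ f → A f → ∃ λ k → enum k ≈B (w ∘ f)
open Small

Large : Baire → Subset → Set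
Large w A = ¬ Small w A

small-⊆ : ∀ {w A B} → A ⊆ B → Small w B → Small w A
small-⊆ A⊆B (covered e cov) = covered e λ f Af → cov f (A⊆B f Af)

large-⊆ : ∀ {w A B} → A ⊆ B → Large w A → Large w B
large-⊆ A⊆B L s = L (small-⊆ A⊆B s)

small-⋃ : ∀ {w A} (B : ℕ → Subset) → (∀ k → Small w (B k)) →
          (∀ f → A f → ∃ λ k → B k f) → Small w A
small-⋃ B s cov =
  covered (λ n → let k , j = unpair n in enum (s k) j) λ f Af →
  let k , Bkf = cov f Af
      j , p   = covers (s k) f Bkf
      n , eq  = unpair-surjective k j
  in n , λ i → trans (cong (λ q → enum (s (proj₁ q)) (proj₂ q) i) eq) (p i)

small-∪ : ∀ {w A B} → Small w A → Small w B → Small w (A ∪ B)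
small-∪ {w} {A} {B} sA sB = small-⋃ pieces small λ where
    f (inj₁ Af) → 0 , Af
    f (inj₂ Bf) → 1 , Bf
  where
  pieces : ℕ → Subset
  pieces zero    = A
  pieces (suc _) = B

  small : ∀ k → Small w (pieces k)
  small zero    = sA
  small (suc _) = sB

-- Adjoining one point to a set of cardinality continuum

-- The points 1ᵏ0^ω make room for the new element, as in Hilbert's hotel.
onesThenZeros : ℕ → Cantor
onesThenZeros k n = n <ᵇ k

onesThenZeros-injective : ∀ k l → onesThenZeros k ≈C onesThenZeros l → k ≡ l
onesThenZeros-injective zero    zero    _ = refl
onesThenZeros-injective zero    (suc l) p with () ← p 0
onesThenZeros-injective (suc k) zero    p with () ← p 0
onesThenZeros-injective (suc k) (suc l) p = cong suc (onesThenZeros-injective k l (p ∘ suc))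

data Room (x : Cantor) : Set where
  first : x ≈C onesThenZeros 0 → Room x
  later : ∀ k → x ≈C onesThenZeros (suc k) → Room x
  other : (∀ k → ¬ (x ≈C onesThenZeros k)) → Room x

module Classical (lem : LEM) where

  by-contradiction : {A : Set} → ¬ ¬ A → A
  by-contradiction {A} ¬¬a = fromInj₁ (⊥-elim ∘ ¬¬a) (lem A)

  -- Splitting large sets at a coordinate.

  At : Baire → ℕ → ℕ → Subset
  At w n a f = w (f n) ≡ a

  opaque
    large-inhabited : ∀ {w A} → Large w A → ∃ A
    large-inhabited L = by-contradiction λ ¬A →
      L (covered (λ _ → id) λ f Af → ⊥-elim (¬A (f , Af)))

  opaque
    large-pigeonhole : ∀ {w A} (B : ℕ → Subset) → Large w A →
                       (∀ f → A f → ∃ λ k → B k f) → ∃ λ k → Large w (A ∩ B k)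
    large-pigeonhole B L cov = by-contradiction λ none →
      L (small-⋃ _ (λ k → by-contradiction λ Lk → none (k , Lk))
                   (λ f Af → let k , Bkf = cov f Af in k , Af , Bkf))

  opaque
    -- At each `n` some value `c n` has a large part. If no other value ever did, all of `A` outside
    -- a countable union of small sets would satisfy `c ≈B (w ∘ f)`, making `A` small.
    large-splits : ∀ {w A} → Large w A →
      ∃ λ n → ∃ λ a → ∃ λ b → a ≢ b × Large w (A ∩ At w n a) × Large w (A ∩ At w n b)
    large-splits {w} {A} L = by-contradiction λ none →
      let
        major : ∀ n → ∃ λ a → Large w (A ∩ At w n a)
        major n = large-pigeonhole (At w n) L (λ f _ → w (f n) , refl)

        c : Baire
        c n = proj₁ (major n)

        -- Putting `a ≢ c n` into the set makes it empty when `a` is `c n`, so smallness can be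
        -- claimed for every `a`.
        Minority : ℕ → ℕ → Subset
        Minority n a f = (a ≢ c n) × (A ∩ At w n a) f

        small-minority : ∀ n a → Small w (Minority n a)
        small-minority n a = by-contradiction λ (Lm : Large w (Minority n a)) →
          let f , a≢c , _ = large-inhabited Lm
          in none (n , a , c n , a≢c , large-⊆ (λ _ → proj₂) Lm , proj₂ (major n))

        small-unlike : Small w (λ f → ∃ λ n → ∃ λ a → Minority n a f)
        small-unlike = small-⋃ (λ n f → ∃ λ a → Minority n a f)
          (λ n → small-⋃ (Minority n) (small-minority n) (λ _ → id)) (λ _ → id)

        small-like : Small w (λ f → c ≈B (w ∘ f))
        small-like = covered (λ _ → c) λ f p → 0 , p

        cover : A ⊆ ((λ f → c ≈B (w ∘ f)) ∪ (λ f → ∃ λ n → ∃ λ a → Minority n a f))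
        cover f Af = [ inj₂
                     , (λ ¬m → inj₁ λ n → by-contradiction λ c≢ →
                          ¬m (n , w (f n) , (c≢ ∘ sym) , Af , refl)) ]′
                     (lem (∃ λ n → ∃ λ a → Minority n a f))
      in L (small-⊆ cover (small-∪ small-like small-unlike))

  -- Cantor's diagonal argument through `φ`: bit `k` of `diagonal` is chosen to differ from that of
  -- a preimage of `e k`, if there is one. Injectivity of `φ` turns a listed `φ diagonal` into a
  -- contradiction.
  continuum⇒large : ∀ {S} → HasContinuumCard S → Large id S
  continuum⇒large {S} (φ , _ , inj , _) (covered e cov) =
    diagonal-missed (cov (proj₁ (φ diagonal)) (proj₂ (φ diagonal)))
    where
    Preimage : ℕ → Set
    Preimage k = ∃ λ x → proj₁ (φ x) ≈B e k

    flip : ∀ k → Preimage k ⊎ ¬ Preimage k → Bool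
    flip k (inj₁ (x , _)) = not (x k)
    flip k (inj₂ _)       = true

    diagonal : Cantor
    diagonal k = flip k (lem (Preimage k))

    diagonal-missed : (∃ λ k → e k ≈B proj₁ (φ diagonal)) → ⊥
    diagonal-missed (k , p) = go (lem (Preimage k)) refl
      where
      go : ∀ d → d ≡ lem (Preimage k) → ⊥
      go (inj₁ (x , q)) eq = not-¬ refl
        (trans (inj x diagonal (≈B-trans q p) k) (cong (flip k) (sym eq)))
      go (inj₂ ¬x)      _  = ¬x (diagonal , ≈B-sym p)

  -- Hilbert's hotel on Cantor space.

  room : ∀ x → Room x
  room x with lem (∃ λ k → x ≈C onesThenZeros k)
  ... | inj₁ (zero  , p) = first p
  ... | inj₁ (suc k , p) = later k p
  ... | inj₂ ¬p          = other λ k p → ¬p (k , p)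

  continuum-adjoin : ∀ {A} g → (∀ {f h} → f ≈B h → A f → A h) →
                     HasContinuumCard A → HasContinuumCard (A ∪ (g ≈B_))
  continuum-adjoin {A} g ext (φ , resp , inj , sur) with lem (A g)
  ... | inj₁ Ag = (λ x → proj₁ (φ x) , inj₁ (proj₂ (φ x))) , resp , inj , λ where
    f (inj₁ Af)  → sur f Af
    f (inj₂ g≈f) → sur f (ext g≈f Ag)
  ... | inj₂ ¬Ag =
        (λ x → ψ (room x))
      , (λ x y → ψ-resp (room x) (room y))
      , (λ x y → ψ-inj (room x) (room y))
      , ψ-sur
    where
    ψ : ∀ {x} → Room x → Σ Baire (A ∪ (g ≈B_))
    ψ (first _)     = g , inj₂ ≈B-refl
    ψ (later k _)   = let f , Af = φ (onesThenZeros k) in f , inj₁ Af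
    ψ {x} (other _) = let f , Af = φ x in f , inj₁ Af

    same-index : ∀ {x y} k l → x ≈C y → x ≈C onesThenZeros k → y ≈C onesThenZeros l → k ≡ l
    same-index k l x≈y p q =
      onesThenZeros-injective k l (≈C-trans (≈C-sym p) (≈C-trans x≈y q))

    ψ-resp : ∀ {x y} (r : Room x) (s : Room y) → x ≈C y → proj₁ (ψ r) ≈B proj₁ (ψ s)
    ψ-resp (first p)   (first q)   e = ≈B-refl
    ψ-resp (first p)   (later l q) e with () ← same-index 0 (suc l) e p q
    ψ-resp (first p)   (other q)   e = ⊥-elim (q 0 (≈C-trans (≈C-sym e) p))
    ψ-resp (later k p) (first q)   e with () ← same-index (suc k) 0 e p q
    ψ-resp (later k p) (later l q) e with refl ← same-index (suc k) (suc l) e p q = ≈B-refl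
    ψ-resp (later k p) (other q)   e = ⊥-elim (q (suc k) (≈C-trans (≈C-sym e) p))
    ψ-resp (other p)   (first q)   e = ⊥-elim (p 0 (≈C-trans e q))
    ψ-resp (other p)   (later l q) e = ⊥-elim (p (suc l) (≈C-trans e q))
    ψ-resp (other p)   (other q)   e = resp _ _ e

    φ≉g : ∀ x → ¬ (proj₁ (φ x) ≈B g)
    φ≉g x e = ¬Ag (ext e (proj₂ (φ x)))

    ψ-inj : ∀ {x y} (r : Room x) (s : Room y) → proj₁ (ψ r) ≈B proj₁ (ψ s) → x ≈C y
    ψ-inj (first p)   (first q)   e = ≈C-trans p (≈C-sym q)
    ψ-inj (first p)   (later l q) e = ⊥-elim (φ≉g _ (≈B-sym e))
    ψ-inj (first p)   (other q)   e = ⊥-elim (φ≉g _ (≈B-sym e))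
    ψ-inj (later k p) (first q)   e = ⊥-elim (φ≉g _ e)
    ψ-inj (later k p) (later l q) e
      with refl ← onesThenZeros-injective k l (inj _ _ e) = ≈C-trans p (≈C-sym q)
    ψ-inj (later k p) (other q)   e = ⊥-elim (q k (≈C-sym (inj _ _ e)))
    ψ-inj (other p)   (first q)   e = ⊥-elim (φ≉g _ e)
    ψ-inj (other p)   (later l q) e = ⊥-elim (p l (inj _ _ e))
    ψ-inj (other p)   (other q)   e = inj _ _ e

    -- `room` decides by `lem` and does not compute; by `ψ-resp` any classification of a point found
    -- by hand yields the same map.
    ψ-at : ∀ {x} (r : Room x) {f} → proj₁ (ψ r) ≈B f → ∃ λ y → proj₁ (ψ (room y)) ≈B f
    ψ-at {x} r e = x , ≈B-trans (ψ-resp (room x) r (λ _ → refl)) e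

    ψ-sur : ∀ f → (A ∪ (g ≈B_)) f → ∃ λ x → proj₁ (ψ (room x)) ≈B f
    ψ-sur f (inj₂ g≈f) = ψ-at (first (λ _ → refl)) g≈f
    ψ-sur f (inj₁ Af) with sur f Af
    ... | y , φy≈f with room y
    -- The value that `φ` takes at `onesThenZeros k` now sits one place later.
    ... | first p   = ψ-at (later 0 (λ _ → refl)) (≈B-trans (resp _ _ (≈C-sym p)) φy≈f)
    ... | later k p = ψ-at (later (suc k) (λ _ → refl)) (≈B-trans (resp _ _ (≈C-sym p)) φy≈f)
    ... | other p   = ψ-at (other p) φy≈f

  -- Colourings separating large basic open sets

  Splits : Subset → (ℕ → Bool) → Baire → Set
  Splits S u w = ∀ g m → Large w (S ∩ Cyl g m) →
    ∃ λ n → ∀ b → Large w ((S ∩ Cyl g m) ∩ (λ f → u (f n) ≡ b))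

  indicator : ℕ → ℕ → Bool
  indicator a k = k ≡ᵇ a

  indicator-self : ∀ a → indicator a a ≡ true
  indicator-self zero    = refl
  indicator-self (suc a) = indicator-self a

  indicator-true : ∀ a k → indicator a k ≡ true → k ≡ a
  indicator-true zero    zero    _ = refl
  indicator-true (suc a) (suc k) p = cong suc (indicator-true a k p)

  bit-injective : ∀ {b c} → bit b ≡ bit c → b ≡ c
  bit-injective {b} {c} p = trans (sym (isOne-bit b)) (trans (cong isOne p) (isOne-bit c))

  -- `bit ∘ u` takes only the values 0 and 1, so the two distinct values supplied by `large-splits`
  -- are the two colours in some order.
  two-valued-splits : ∀ S u → Splits S u (bit ∘ u)
  two-valued-splits S u g m L =
    let n , a , b , a≢b , La , Lb = large-splits L
        f , _ , fa = large-inhabited La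
        h , _ , hb = large-inhabited Lb
    in n , λ c → choose n c (u (f n)) (u (h n)) a≢b fa hb La Lb
    where
    Part : ℕ → Bool → Subset
    Part n c = (S ∩ Cyl g m) ∩ (λ f → u (f n) ≡ c)

    part : ∀ n {a} c → bit c ≡ a → Large (bit ∘ u) ((S ∩ Cyl g m) ∩ At (bit ∘ u) n a) →
           Large (bit ∘ u) (Part n c)
    part n c refl = large-⊆ λ h (Sh , p) → Sh , bit-injective p

    choose : ∀ n c c₁ c₂ {a b} → a ≢ b → bit c₁ ≡ a → bit c₂ ≡ b →
             Large (bit ∘ u) ((S ∩ Cyl g m) ∩ At (bit ∘ u) n a) →
             Large (bit ∘ u) ((S ∩ Cyl g m) ∩ At (bit ∘ u) n b) →
             Large (bit ∘ u) (Part n c)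
    choose n false false _     _  p _ La Lb = part n _ p La
    choose n true  true  _     _  p _ La Lb = part n _ p La
    choose n false true  false _  _ q La Lb = part n _ q Lb
    choose n true  false true  _  _ q La Lb = part n _ q Lb
    choose n true  false false ne p q _  _  = ⊥-elim (ne (trans (sym p) q))
    choose n false true  true  ne p q _  _  = ⊥-elim (ne (trans (sym p) q))

  opaque
    -- Induction on `N`: the maps `indicator N ∘ f` for `f` in `S` form a countable family, so by
    -- pigeonhole a large subset shares one of them, which fixes the fibre over `N`. Exchanging `f`
    -- and `g` turns the implication into equality of fibres.
    large-constant-fibres : ∀ {S} → (∀ a → Small (bit ∘ indicator a) S) →
      ∀ N {A} → A ⊆ S → Large id A →
      Σ Subset λ A′ → (A′ ⊆ A) × Large id A′ ×
        (∀ c → c < N → ∀ f g → A′ f → A′ g → ∀ n → f n ≡ c → g n ≡ c)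
    large-constant-fibres small zero    {A} A⊆S L = A , (λ _ → id) , L , λ _ ()
    large-constant-fibres {S} small (suc N) A⊆S L
      with large-constant-fibres small N A⊆S L
    ... | A′ , A′⊆A , L′ , const
      with small N
    ... | covered e cov
      with large-pigeonhole (λ k f → e k ≈B (bit ∘ indicator N ∘ f)) L′
             (λ f A′f → cov f (A⊆S f (A′⊆A f A′f)))
    ... | k , L″ = _ , (λ f → A′⊆A f ∘ proj₁) , L″ , const′
      where
      const′ : ∀ c → c < suc N → ∀ f g → (A′ ∩ (λ f → e k ≈B (bit ∘ indicator N ∘ f))) f →
               (A′ ∩ (λ f → e k ≈B (bit ∘ indicator N ∘ f))) g → ∀ n → f n ≡ c → g n ≡ c
      const′ c (s≤s c≤N) f g (A′f , ef) (A′g , eg) n fn≡c with m≤n⇒m<n∨m≡n c≤N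
      ... | inj₁ c<N  = const c c<N f g A′f A′g n fn≡c
      ... | inj₂ refl = indicator-true N (g n) (trans
        (bit-injective (trans (sym (eg n)) (ef n)))
        (trans (cong (indicator N) fn≡c) (indicator-self N)))

  opaque
    -- On `A′` the fibres over values below `N` are frozen, whereas at `n` one member takes the
    -- value `a` and another `b`; hence neither value is below `N`.
    fresh-split : ∀ {S} → (∀ a → Small (bit ∘ indicator a) S) →
      ∀ N {A} → A ⊆ S → Large id A →
      ∃ λ a → ∃ λ b → N ≤ a × N ≤ b × a ≢ b ×
        (∃ λ n → Large id (A ∩ At id n a) × Large id (A ∩ At id n b))
    fresh-split small N A⊆S L with large-constant-fibres small N A⊆S L
    ... | A′ , A′⊆A , L′ , const with large-splits L′
    ... | n , a , b , a≢b , La , Lb =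
      let f , A′f , fn≡a = large-inhabited La
          g , A′g , gn≡b = large-inhabited Lb
      in a , b
       , ≮⇒≥ (λ a<N → a≢b (trans (sym (const a a<N f g A′f A′g n fn≡a)) gn≡b))
       , ≮⇒≥ (λ b<N → a≢b (trans (sym fn≡a) (const b b<N g f A′g A′f n gn≡b)))
       , a≢b
       , n
       , large-⊆ (λ h (A′h , p) → A′⊆A h A′h , p) La
       , large-⊆ (λ h (A′h , p) → A′⊆A h A′h , p) Lb

  -- Greedy choice: each pair lies above all earlier ones, so no `a k` equals any `b l`, and exactly
  -- the `b l` can be coloured `true`.
  colour-fresh-pairs : (Q : ℕ → ℕ → ℕ → Set) →
    (∀ k N → ∃ λ a → ∃ λ b → N ≤ a × N ≤ b × a ≢ b × Q k a b) →
    Σ (ℕ → Bool) λ u → ∀ k → ∃ λ a → ∃ λ b → Q k a b × u a ≡ false × u b ≡ true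
  colour-fresh-pairs Q pick = u , λ k → a k , b k , Qab k , u-a k , u-b k
    where
    bound : ℕ → ℕ
    bound zero    = 0
    bound (suc k) = let a , b , _ = pick k (bound k) in suc (bound k + (a + b))

    a b : ℕ → ℕ
    a k = proj₁ (pick k (bound k))
    b k = proj₁ (proj₂ (pick k (bound k)))

    bound≤a : ∀ k → bound k ≤ a k
    bound≤a k = let _ , _ , p , _ = pick k (bound k) in p

    bound≤b : ∀ k → bound k ≤ b k
    bound≤b k = let _ , _ , _ , p , _ = pick k (bound k) in p

    a≢b : ∀ k → a k ≢ b k
    a≢b k = let _ , _ , _ , _ , p , _ = pick k (bound k) in p

    Qab : ∀ k → Q k (a k) (b k)
    Qab k = let _ , _ , _ , _ , _ , p = pick k (bound k) in p

    bound-mono : ∀ {k l} → k ≤ l → bound k ≤ bound l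
    bound-mono {l = zero}  z≤n = ≤-refl
    bound-mono {l = suc l} k≤1+l with m≤n⇒m<n∨m≡n k≤1+l
    ... | inj₁ (s≤s k≤l) = ≤-trans (bound-mono k≤l) (m≤n⇒m≤1+n (m≤m+n (bound l) _))
    ... | inj₂ refl      = ≤-refl

    a<bound : ∀ k → a k < bound (suc k)
    a<bound k = s≤s (≤-trans (m≤m+n (a k) (b k)) (m≤n+m _ (bound k)))

    b<bound : ∀ k → b k < bound (suc k)
    b<bound k = s≤s (≤-trans (m≤n+m (b k) (a k)) (m≤n+m _ (bound k)))

    a≢b′ : ∀ k l → a k ≢ b l
    a≢b′ k l with <-cmp k l
    ... | tri< k<l _ _  = <⇒≢ (<-≤-trans (a<bound k) (≤-trans (bound-mono k<l) (bound≤b l)))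
    ... | tri≈ _ refl _ = a≢b k
    ... | tri> _ _ l<k  = >⇒≢ (<-≤-trans (b<bound l) (≤-trans (bound-mono l<k) (bound≤a k)))

    u : ℕ → Bool
    u i = [ (λ _ → true) , (λ _ → false) ]′ (lem (∃ λ k → b k ≡ i))

    u-a : ∀ k → u (a k) ≡ false
    u-a k with lem (∃ λ l → b l ≡ a k)
    ... | inj₁ (l , p) = ⊥-elim (a≢b′ k l (sym p))
    ... | inj₂ _       = refl

    u-b : ∀ k → u (b k) ≡ true
    u-b k with lem (∃ λ l → b l ≡ b k)
    ... | inj₁ _ = refl
    ... | inj₂ p = ⊥-elim (p (k , refl))

  small-fibres-splits : ∀ {S} → (∀ a → Small (bit ∘ indicator a) S) →
                        ∃ λ u → Splits S u id
  small-fibres-splits {S} small = u , splits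
    where
    SplitAt : ℕ → ℕ → ℕ → Set
    SplitAt k a b = Large id (S ∩ cylAt k) →
      ∃ λ n → Large id ((S ∩ cylAt k) ∩ At id n a) × Large id ((S ∩ cylAt k) ∩ At id n b)

    pick : ∀ k N → ∃ λ a → ∃ λ b → N ≤ a × N ≤ b × a ≢ b × SplitAt k a b
    pick k N with lem (Large id (S ∩ cylAt k))
    ... | inj₁ L =
      let a , b , N≤a , N≤b , a≢b , sp = fresh-split small N (λ _ → proj₁) L
      in a , b , N≤a , N≤b , a≢b , λ _ → sp
    -- `SplitAt` demands nothing of a cylinder that is not large, so any two distinct values from
    -- `N` on will do.
    ... | inj₂ ¬L = N , suc N , ≤-refl , n≤1+n N , <⇒≢ (n<1+n N) , λ L → ⊥-elim (¬L L)

    colouring = colour-fresh-pairs SplitAt pick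
    u = proj₁ colouring

    splits : Splits S u id
    splits g m L with cylAt-surjective g m
    ... | k , k⊆ , ⊆k with proj₂ colouring k
    ... | a , b , sp , ua , ub with sp (large-⊆ (λ f (Sf , p) → Sf , ⊆k f p) L)
    ... | n , La , Lb = n , λ where
        false → part ua La
        true  → part ub Lb
      where
      part : ∀ {a c} → u a ≡ c → Large id ((S ∩ cylAt k) ∩ At id n a) →
             Large id ((S ∩ Cyl g m) ∩ (λ f → u (f n) ≡ c))
      part p = large-⊆ λ f ((Sf , q) , fn≡a) → (Sf , k⊆ f q) , trans (cong u fn≡a) p

  splitting-colouring : ∀ {S} → Large id S → ∃ λ u → ∃ λ w → Large w S × Splits S u w
  splitting-colouring {S} L with lem (∃ λ a → Large (bit ∘ indicator a) S)
  ... | inj₁ (a , La) = indicator a , _ , La , two-valued-splits S (indicator a)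
  ... | inj₂ none =
    let u , sp = small-fibres-splits (λ a → by-contradiction λ La → none (a , La))
    in u , id , L , sp

  large-cylinder : ∀ {w A} m → Large w A → ∃ λ g → Large w (A ∩ Cyl g m)
  large-cylinder m L =
    let c , Lc = large-pigeonhole (λ c → Cyl (finite m c) m) L λ f _ →
                   let c , ag = finite-surjective m f in c , λ i i<m → sym (ag i i<m)
    in finite m c , Lc

  -- The Cantor scheme of large cylinders.

  module Scheme (S : Subset) (closed : IsClosed S) (u : ℕ → Bool) (w : Baire)
                (large : Large w S) (splits : Splits S u w) where

    record Node : Set where
      constructor node
      field
        centre  : Baire
        radius  : ℕ
        isLarge : Large w (S ∩ Cyl centre radius)
    open Node

    coord : Node → ℕ
    coord (node g m L) = proj₁ (splits g m L)

    -- The bound `coord s < radius t` fixes the colour at the splitting coordinate on the whole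
    -- cylinder of `t`, so that it passes to the limit.
    Child : Node → Bool → Set
    Child s b = Σ Node λ t → radius s < radius t × coord s < radius t ×
      Agree (radius s) (centre t) (centre s) × u (centre t (coord s)) ≡ b

    hasChild : ∀ s b → Child s b
    hasChild s@(node g m L) b =
        node g′ m′ (large-⊆ (λ f (((Sf , _) , _) , p) → Sf , p) L′)
      , m<m′ , n<m′
      , (λ i i<m → trans (sym (f≈g′ i (<-trans i<m m<m′))) (f≈g i i<m))
      , trans (cong u (sym (f≈g′ n n<m′))) ufn≡b
      where
      n  = coord s
      m′ = suc (m + n)

      m<m′ : m < m′
      m<m′ = s≤s (m≤m+n m n)

      n<m′ : n < m′
      n<m′ = s≤s (m≤n+m n m)

      refined = large-cylinder m′ (proj₂ (splits g m L) b)
      g′ = proj₁ refined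
      L′ = proj₂ refined

      -- The centre `g′` need not lie in `S`. A member `f` of the refined set agrees with both
      -- centres and carries agreement and colour over to `g′`.
      member = proj₂ (large-inhabited L′)
      f≈g    = proj₂ (proj₁ (proj₁ member))
      ufn≡b  = proj₂ (proj₁ member)
      f≈g′   = proj₂ member

    child : Node → Bool → Node
    child s b = proj₁ (hasChild s b)

    -- Radius 1 makes f 0 constant on the whole scheme.
    root : Node
    root = let g , L = large-cylinder 1 large in node g 1 L

    path : Cantor → ℕ → Node
    path x zero    = root
    path x (suc k) = child (path x k) (x k)

    path-cong : ∀ {x y} k → (∀ i → i < k → x i ≡ y i) → path x k ≡ path y k
    path-cong zero    p = refl
    path-cong (suc k) p =
      cong₂ child (path-cong k (λ i i<k → p i (m<n⇒m<1+n i<k))) (p k ≤-refl)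

    module _ (x : Cantor) where

      radius-path : ∀ k → k < radius (path x k)
      radius-path zero    = z<s
      radius-path (suc k) =
        ≤-trans (s<s (radius-path k)) (proj₁ (proj₂ (hasChild (path x k) (x k))))

      path-agree : ∀ {k l} → k ≤ l →
        (radius (path x k) ≤ radius (path x l)) ×
        Agree (radius (path x k)) (centre (path x l)) (centre (path x k))
      path-agree {l = zero} z≤n = ≤-refl , λ _ _ → refl
      path-agree {l = suc l} k≤1+l with m≤n⇒m<n∨m≡n k≤1+l
      ... | inj₂ refl = ≤-refl , λ _ _ → refl
      ... | inj₁ (s≤s k≤l) =
        let r , ag = path-agree k≤l
            _ , r′ , _ , ag′ , _ = hasChild (path x l) (x l)
        in ≤-trans r (<⇒≤ r′) , λ i i<r → trans (ag′ i (<-≤-trans i<r r)) (ag i i<r)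

      -- At level `suc i` the radius exceeds `i`, so entry `i` of the centre no longer changes.
      limit : Baire
      limit i = centre (path x (suc i)) i

      limit-agree : ∀ k → Agree (radius (path x k)) limit (centre (path x k))
      limit-agree k i i<r with ≤-total k (suc i)
      ... | inj₁ k≤i = proj₂ (path-agree k≤i) i i<r
      ... | inj₂ i≤k = sym (proj₂ (path-agree i≤k) i (<-trans (n<1+n i) (radius-path (suc i))))

      -- The centres may lie outside `S`, but each large cylinder along the path contains a member
      -- of `S`, and these members approximate the limit.
      limit-∈ : S limit
      limit-∈ = closed limit λ k →
        let f , Sf , p = large-inhabited (isLarge (path x k))
        in f , Sf , λ i i<k →
             let i<r = <-trans i<k (radius-path k)
             in trans (p i i<r) (sym (limit-agree k i i<r))

      limit-coord : ∀ k → u (limit (coord (path x k))) ≡ x k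
      limit-coord k =
        let _ , _ , n<r , _ , eq = hasChild (path x k) (x k)
        in trans (cong u (limit-agree (suc k) _ n<r)) eq

    -- Coloured branches and their decoding.

    colour : Baire
    colour = bit ∘ u

    shift : Baire
    shift 0             = 0
    shift 1             = 0
    shift (suc (suc n)) = n

    H : Cantor → Baire
    H x = colour ∘ limit x ∘ shift

    c : ℕ
    c = colour (centre root 0)

    H-bit : ∀ x b → H x (bit b) ≡ c
    H-bit x false = cong colour (limit-agree x 0 0 z<s)
    H-bit x true  = cong colour (limit-agree x 0 0 z<s)

    H-coord : ∀ x k → isOne (H x (2 + coord (path x k))) ≡ x k
    H-coord x k = trans (isOne-bit _) (limit-coord x k)

    H-cong : ∀ x y → x ≈C y → H x ≈B H y
    H-cong x y p n = cong (λ s → colour (centre s (shift n)))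
      (path-cong (suc (shift n)) (λ i _ → p i))

    -- Descends the scheme along bits read off `h` itself. An arbitrary `h` is allowed because
    -- closedness requires decoding a limit of branches before it is known to be a branch.
    module Decode (h : Baire) where

      nodes : ℕ → Node
      nodes zero    = root
      nodes (suc k) = child (nodes k) (isOne (h (2 + coord (nodes k))))

      decode : Cantor
      decode k = isOne (h (2 + coord (nodes k)))

      path-decode : ∀ k → path decode k ≡ nodes k
      path-decode zero    = refl
      path-decode (suc k) = cong (λ s → child s (decode k)) (path-decode k)

      -- Bits are read one position at a time. Once the earlier bits of `y` match, its path has
      -- reached the same node, so its next bit shows at the same position.
      decode-continuous : ∀ k → ∃ λ M → ∀ y → Agree M (H y) h → ∀ i → i < k → y i ≡ decode i
      decode-continuous zero = 0 , λ _ _ _ ()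
      decode-continuous (suc k) with decode-continuous k
      -- This covers the earlier bound and position `2 + coord (nodes k)`; `Agree` is strict, hence
      -- the 3.
      ... | M , rec = M + (3 + coord (nodes k)) , step
        where
        step : ∀ y → Agree (M + (3 + coord (nodes k))) (H y) h →
               ∀ i → i < suc k → y i ≡ decode i
        step y ag i (s≤s i≤k) with m≤n⇒m<n∨m≡n i≤k
        ... | inj₁ i<k = rec y (λ j j<M → ag j (<-≤-trans j<M (m≤m+n M _))) i i<k
        ... | inj₂ refl = begin
          y i                                  ≡⟨ H-coord y i ⟨
          isOne (H y (2 + coord (path y i)))   ≡⟨ cong (λ s → isOne (H y (2 + coord s))) same ⟩
          isOne (H y (2 + coord (nodes i)))    ≡⟨ cong isOne (ag _ (m≤n+m _ M)) ⟩
          decode i                             ∎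
          where
          open ≡-Reasoning
          same : path y i ≡ nodes i
          same = trans
            (path-cong i (rec y (λ j j<M → ag j (<-≤-trans j<M (m≤m+n M _)))))
            (path-decode i)

      -- Continuity of decoding replaces compactness of Cantor space: an approximant close enough to
      -- `h` shares enough bits with `decode` to give the same value at `n`.
      H-decode : (∀ n → ∃ λ y → Agree n (H y) h) → H decode ≈B h
      H-decode approx n =
        -- `limit` reads its entry `shift n` at level `suc (shift n)`.
        let M , cont = decode-continuous (suc (shift n))
            y , ag   = approx (M + suc n)
        in trans
             (cong (λ s → colour (centre s (shift n)))
               (sym (path-cong (suc (shift n))
                 (cont y λ j j<M → ag j (<-≤-trans j<M (m≤m+n M _))))))
             (ag n (m≤n+m (suc n) M))

    open Decode

    H-injective : ∀ x y → H x ≈B H y → x ≈C y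
    H-injective x y p k =
      let M , cont = decode-continuous (H x) (suc k)
      in trans (cont x (λ _ _ → refl) k ≤-refl)
               (sym (cont y (λ i _ → sym (p i)) k ≤-refl))

    -- The closed semigroup `T`.

    Branches : Subset
    Branches h = ∃ λ x → H x ≈B h

    T : Subset
    T = Branches ∪ ((λ _ → c) ≈B_)

    T-bit-valued : ∀ {f} → T f → ∀ n → ∃ λ b → f n ≡ bit b
    T-bit-valued (inj₁ (x , p)) n = _ , sym (p n)
    T-bit-valued (inj₂ p)       n = _ , sym (p n)

    T-at-bit : ∀ {f} → T f → ∀ b → f (bit b) ≡ c
    T-at-bit (inj₁ (x , p)) b = trans (sym (p (bit b))) (H-bit x b)
    T-at-bit (inj₂ p)       b = sym (p (bit b))

    T⊆F₂ : T ⊆ F₂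
    T⊆F₂ f Tf = 0 , 1 , λ n → zero-or-one (T-bit-valued Tf n)
      where
      zero-or-one : ∀ {k} → (∃ λ b → k ≡ bit b) → k ≡ 0 ⊎ k ≡ 1
      zero-or-one (false , p) = inj₁ p
      zero-or-one (true  , p) = inj₂ p

    T-subsemigroup : IsSubsemigroup T
    T-subsemigroup f g Tf Tg = inj₂ λ n →
      let b , p = T-bit-valued Tg n in sym (trans (cong f p) (T-at-bit Tf b))

    T-closed : IsClosed T
    T-closed h approx with lem (∃ λ n → h n ≢ c)
    ... | inj₂ none = inj₂ λ n → sym (by-contradiction λ ne → none (n , ne))
    ... | inj₁ (n , hn≢c) = inj₁ (decode h , H-decode h branch)
      where
      branch : ∀ m → ∃ λ y → Agree m (H y) h
      -- Long enough to reach `n`, where `h` differs from `c`; this excludes the constant map as an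
      -- approximant.
      branch m with approx (m + suc n)
      ... | f , inj₁ (y , p) , ag = y , λ i i<m → trans (p i) (ag i (<-≤-trans i<m (m≤m+n m _)))
      ... | f , inj₂ p       , ag = ⊥-elim (hn≢c (sym (trans (p n) (ag n (m≤n+m (suc n) m)))))

    -- The constant map may or may not be a branch; `continuum-adjoin` covers both cases.
    T-continuum : HasContinuumCard T
    T-continuum = continuum-adjoin (λ _ → c) (λ p (x , q) → x , ≈B-trans q p)
      ((λ x → H x , x , ≈B-refl) , H-cong , H-injective , λ _ → id)

    extra : ℕ → Baire
    extra 0 = colour
    extra 1 = shift
    extra _ = λ _ → c

    T≼S : T ≼ S
    T≼S = (λ f → ∃ λ k → extra k ≈B f) , (extra , λ _ → id) , λ where
        f (inj₁ (x , p)) → gen-ext (gen-comp (fromExtra 0)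
                             (gen-comp (gen-base (inj₁ (limit-∈ x))) (fromExtra 1))) p
        f (inj₂ p)       → gen-ext (fromExtra 2) p
      where
      fromExtra : ∀ k → Gen (S ∪ (λ f → ∃ λ k → extra k ≈B f)) (extra k)
      fromExtra k = gen-base (inj₂ (k , ≈B-refl))

theorem3p1 : LEM → (S : Subset) → IsSubsemigroup S → IsClosed S →
    HasContinuumCard S →
    Σ Subset λ T → (T ⊆ F₂) × IsSubsemigroup T × IsClosed T ×
      HasContinuumCard T × (T ≼ S)
theorem3p1 lem S _ closed card =
  let open Classical lem
      u , w , large , splits = splitting-colouring (continuum⇒large card)
      open Scheme S closed u w large splits
  in T , T⊆F₂ , T-subsemigroup , T-closed , T-continuum , T≼S
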